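{- Let $P$ be a hereditary property of graphs above the constant layer, i.e. whose speed is not constant ($P_n\neq\Theta(1)$). Then the speed of $P$ is polynomial (that is, $P_n=n^{\Theta(1)}$) if and only if there is a constant $k$ such that every graph $G\in P$ has complex degree $c\Delta(G)\le k$ and $c$-matching number $c\mu(G)\le k$.
   Context: All graphs are finite, simple and undirected. A graph property is an infinite class of graphs closed under isomorphism. A property is hereditary if it is closed under taking induced subgraphs. $P_n$ denotes the number of labelled graphs on the vertex set $\{1,\dots,n\}$ that belong to $P$; the function $n\mapsto P_n$ is the speed of $P$. For a vertex $v$ of $G$, let $d(v)$ be its degree in $G$, let $\overline{d}(v)$ be its degree in the complement $\overline{G}$, and let $cd(v)=\min(d(v),\overline{d}(v))$. The complex degree of $G$ is $c\Delta(G)=\max_{v\in V(G)}cd(v)$. Let $\mu(G)$ be the size of a maximum matching in $G$ (a matching is a set of edges no two of which share a vertex), and let $\overline{\mu}(G)=\mu(\overline{G})$. The $c$-matching number of $G$ is $c\mu(G)=\min(\mu(G),\overline{\mu}(G))$. -}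

module Defs where

open import Data.Bool using (Bool; true; false; not; _∧_; T?)
open import Data.Bool.Properties using (∧-zeroʳ)
open import Data.Fin using (Fin; _<?_; _≟_)
open import Data.Fin.Subset using (Subset; ∣_∣)
open import Data.List using (List; []; _∷_; _++_; map; filter; length; allFin; cartesianProduct)
open import Data.List.Extrema.Nat using (max)
open import Data.List.Relation.Unary.Any using (Any)
open import Data.List.Relation.Unary.AllPairs using (allPairs?)
open import Data.Nat using (ℕ; _⊓_; _*_; _^_; _≤_; _<_)
open import Data.Product using (Σ; ∃-syntax; _×_; _,_; proj₂)
import Data.Vec as Vec
open import Function.Bundles using (Inverse; Injection; _↔_; _↣_; mk⇔)
open import Level using (Level; suc; 0ℓ)
open import Relation.Binary.Bundles using (Setoid)
open import Relation.Binary.Definitions using (Decidable)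
open import Relation.Binary.PropositionalEquality
  using (_≡_; _≢_; refl; sym; trans; cong; cong₂; setoid)
open import Relation.Nullary using (¬_; does)
open import Relation.Nullary.Decidable using (_×-dec_; ¬?; dec-true; does-⇔)

private
  variable
    ℓ : Level
    m n : ℕ

record Graph (n : ℕ) : Set where
  field
    adj        : Fin n → Fin n → Bool
    adj-irrefl : ∀ i → adj i i ≡ false
    adj-sym    : ∀ i j → adj i j ≡ adj j i

open Graph public

complement : Graph n → Graph n
complement G .adj i j = not (adj G i j) ∧ not (does (i ≟ j))
complement G .adj-irrefl i =
  trans (cong (λ b → not (adj G i i) ∧ not b) (dec-true (i ≟ i) refl))
        (∧-zeroʳ (not (adj G i i)))
complement G .adj-sym i j =
  cong₂ (λ a b → not a ∧ not b) (adj-sym G i j)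
        (does-⇔ (mk⇔ sym sym) (i ≟ j) (j ≟ i))

-- The subgraph of G induced on the image of f, with its vertices
-- relabelled by Fin m along f.
induced : Graph n → Fin m ↣ Fin n → Graph m
induced G f .adj i j      = adj G (Injection.to f i) (Injection.to f j)
induced G f .adj-irrefl i = adj-irrefl G (Injection.to f i)
induced G f .adj-sym i j  = adj-sym G (Injection.to f i) (Injection.to f j)

_≅_ : Graph m → Graph n → Set
_≅_ {m} {n} G H =
  Σ (Fin m ↔ Fin n) λ f →
    ∀ i j → adj G i j ≡ adj H (Inverse.to f i) (Inverse.to f j)

neighbours : Graph n → Fin n → Subset n
neighbours G v = Vec.tabulate (adj G v)

degree : Graph n → Fin n → ℕ
degree G v = ∣ neighbours G v ∣

cd : Graph n → Fin n → ℕ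
cd G v = degree G v ⊓ degree (complement G) v

cΔ : Graph n → ℕ
cΔ {n} G = max 0 (map (cd G) (allFin n))

-- Each edge {i , j} is listed exactly once, as the pair with i < j.
edges : Graph n → List (Fin n × Fin n)
edges {n} G =
  filter (λ (i , j) → (i <? j) ×-dec T? (adj G i j))
         (cartesianProduct (allFin n) (allFin n))

NoSharedVertex : Fin n × Fin n → Fin n × Fin n → Set
NoSharedVertex (i , j) (k , l) = i ≢ k × i ≢ l × j ≢ k × j ≢ l

noSharedVertex? : Decidable (NoSharedVertex {n})
noSharedVertex? (i , j) (k , l) =
  ¬? (i ≟ k) ×-dec ¬? (i ≟ l) ×-dec ¬? (j ≟ k) ×-dec ¬? (j ≟ l)

sublists : {A : Set} → List A → List (List A)
sublists []       = [] ∷ []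
sublists (x ∷ xs) = map (x ∷_) (sublists xs) ++ sublists xs

-- `edges` has no repetitions, so its sublists are exactly the edge sets.
matchings : Graph n → List (List (Fin n × Fin n))
matchings G = filter (allPairs? noSharedVertex?) (sublists (edges G))

μ : Graph n → ℕ
μ G = max 0 (map length (matchings G))

cμ : Graph n → ℕ
cμ G = μ G ⊓ μ (complement G)

GraphClass : (ℓ : Level) → Set (suc ℓ)
GraphClass ℓ = ∀ n → Graph n → Set ℓ

IsoClosed : GraphClass ℓ → Set ℓ
IsoClosed P = ∀ {m n} {G : Graph m} {H : Graph n} → G ≅ H → P m G → P n H

-- Up to isomorphism, no finite list of graphs exhausts the class.
Infinite : GraphClass ℓ → Set ℓ
Infinite P =
  ¬ (∃[ L ] ∀ {n} (G : Graph n) → P n G →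
       Any (λ (H : Σ ℕ Graph) → G ≅ proj₂ H) L)

record IsProperty (P : GraphClass ℓ) : Set ℓ where
  field
    isoClosed : IsoClosed P
    infinite  : Infinite P

Hereditary : GraphClass ℓ → Set ℓ
Hereditary P =
  ∀ {m n} (G : Graph n) (f : Fin m ↣ Fin n) → P n G → P m (induced G f)

-- The members of P with vertex set Fin n.  Two labelled graphs are the same
-- when they have the same adjacencies; membership proofs are not counted.
labelledMembers : GraphClass ℓ → ℕ → Setoid ℓ 0ℓ
labelledMembers P n = record
  { Carrier       = Σ (Graph n) (P n)
  ; _≈_           = λ (G , _) (H , _) → ∀ i j → adj G i j ≡ adj H i j
  ; isEquivalence = record
    { refl  = λ i j → refl
    ; sym   = λ G≈H i j → sym (G≈H i j)
    ; trans = λ G≈H H≈K i j → trans (G≈H i j) (H≈K i j)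
    }
  }

-- p is the speed of P: for every n, exactly p n labelled graphs on n vertices
-- belong to P.  Classically every class has exactly one speed; constructively
-- a speed exists precisely when membership in an isomorphism-closed P is
-- decidable.
IsSpeed : GraphClass ℓ → (ℕ → ℕ) → Set ℓ
IsSpeed P p = ∀ n → Inverse (setoid (Fin (p n))) (labelledMembers P n)

Eventually : (ℕ → Set) → Set
Eventually Q = ∃[ n₀ ] ∀ n → n₀ ≤ n → Q n

-- The constants hidden in Θ(1) are positive reals; since a lower constant may
-- be decreased and an upper one increased, positive rationals a / b suffice.

-- p n = Θ(1):  a₁ / b₁ ≤ p n ≤ a₂ / b₂ for all large n.
ConstantSpeed : (ℕ → ℕ) → Set
ConstantSpeed p =
  ∃[ a₁ ] ∃[ b₁ ] ∃[ a₂ ] ∃[ b₂ ]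
    (0 < a₁ × 0 < b₁ × 0 < a₂ × 0 < b₂) ×
    Eventually (λ n → a₁ ≤ b₁ * p n × b₂ * p n ≤ a₂)

-- p n = n ^ Θ(1):  n ^ (a₁ / b₁) ≤ p n ≤ n ^ (a₂ / b₂) for all large n.
PolynomialSpeed : (ℕ → ℕ) → Set
PolynomialSpeed p =
  ∃[ a₁ ] ∃[ b₁ ] ∃[ a₂ ] ∃[ b₂ ]
    (0 < a₁ × 0 < b₁ × 0 < a₂ × 0 < b₂) ×
    Eventually (λ n → n ^ a₁ ≤ p n ^ b₁ × p n ^ b₂ ≤ n ^ a₂)

{-# OPTIONS --safe #-}

-- If n ↦ p n grows polynomially, then p (2t) < 2 ^ t for some t.  A vertex with many neighbours
-- and many non-neighbours realises every neighbourhood of a vertex in a smaller labelled graph.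
-- Likewise, if G and its complement both have large matchings, then off any few vertices there
-- are an edge and a non-edge, hence x, y, z with x adjacent to y and not to z; t disjoint such
-- triples realise every pattern of adjacencies on t disjoint pairs.  So either parameter being
-- large forces p (2t) ≥ 2 ^ t.
--
-- Conversely, if both parameters are at most k, a maximum matching of G or of its complement gives
-- 2k vertices off which the graph is homogeneous, and each of them is described by at most k
-- vertices, so p n is at most polynomial.  For the lower bound, a vertex v adjacent to x and not
-- to y yields n distinct pairs of relabellings, so n ≤ p n ^ 2.  If some p n counted only
-- homogeneous graphs (n ≥ 3), so would all later ones by heredity, and the speed would be constant.

module Submission where

open import Defs
open import Data.Bool using (Bool; true; false; not; _xor_; if_then_else_)
import Data.Bool as Bool
open import Data.Bool.Properties using (¬-not; not-involutive; ∧-identityʳ; T-≡)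
open import Data.Fin
  using (Fin; zero; suc; _↑ˡ_; _↑ʳ_; splitAt; combine; remQuot; finToFun; funToFin; punchOut; inject≤)
import Data.Fin as Fin
open import Data.Fin.Patterns using (0F; 1F; 2F)
open import Data.Fin.Permutation using (transpose)
import Data.Fin.Permutation.Components as Components
open import Data.Fin.Properties
  using (all?; any?; injective⇒≤; <-cmp; 2↔Bool; +↔⊎; *↔×; inject≤-injective; combine-injective;
         funToFin-finToFin; splitAt-↑ˡ; splitAt-↑ʳ; punchIn-injective; punchOut-injective; punchIn-punchOut)
open import Data.Fin.Subset using (∣_∣)
open import Data.List
  using (List; []; _∷_; map; filter; length; lookup; tabulate; allFin; concatMap; upTo; cartesianProduct)
open import Data.List.Extrema.Nat using (xs≤max; max≤v⁺; argmax-sel)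
open import Data.List.Membership.Propositional using (_∈_; _∉_; lose)
open import Data.List.Membership.Propositional.Properties
  using (∈-allFin; ∈-cartesianProduct⁺; ∈-concatMap⁺; ∈-filter⁺; ∈-filter⁻; ∈-lookup; ∈-map⁺; ∈-map⁻;
         ∈-++⁺ˡ; ∈-++⁺ʳ; ∈-++⁻; ∈-upTo⁺)
open import Data.List.Relation.Binary.Permutation.Propositional
  using (_↭_; prep; ↭-refl; ↭-sym; ↭-trans; ↭-swap; ↭⇒↭ₛ)
open import Data.List.Relation.Binary.Permutation.Propositional.Properties using (↭-length)
import Data.List.Relation.Binary.Permutation.Setoid.Properties as Permutationₛ
open import Data.List.Relation.Unary.All as All using (_∷_; [])
open import Data.List.Relation.Unary.All.Properties using (¬All⇒Any¬; map⁺; tabulate⁺)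
open import Data.List.Relation.Unary.AllPairs using (AllPairs; []; _∷_; allPairs?)
open import Data.List.Relation.Unary.Any as Any using (Any; here; there)
open import Data.List.Relation.Unary.Unique.Propositional using (Unique)
open import Data.List.Relation.Unary.Unique.Propositional.Properties using (allFin⁺; filter⁺)
open import Data.Nat
  using (ℕ; zero; suc; _+_; _*_; _^_; _⊔_; _≤_; _<_; z≤n; s≤s; z<s; s<s; _≤′_; ≤′-refl; ≤′-step; _<?_)
import Data.Nat.Properties as ℕ
open import Data.Nat.Solver using (module +-*-Solver)
open import Data.Product using (Σ; ∃; ∃-syntax; _×_; _,_; proj₁; proj₂)
open import Data.Product.Properties using (,-injective)
open import Data.Sum as Sum using (_⊎_; inj₁; inj₂)
open import Data.Vec using (Vec; []; _∷_)
import Data.Vec as Vec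
open import Data.Vec.Membership.DecPropositional using (_∈?_)
open import Data.Vec.Membership.Propositional using () renaming (_∈_ to _∈ᵥ_)
import Data.Vec.Properties as Vec
open import Data.Vec.Relation.Unary.Any using (here; there; index)
import Data.Vec.Relation.Unary.Any.Properties as Anyᵥ
open import Function using (_∘_; id)
open import Function.Bundles using (Equivalence; Inverse; Injection; _⇔_; mk⇔; _↣_; mk↣)
open import Function.Construct.Identity using (↔-id)
open import Function.Properties.Inverse using (↔⇒↣; ↔-sym)
open import Level using (Level)
open import Relation.Binary.Definitions using (Symmetric; tri<; tri≈; tri>)
open import Relation.Binary.PropositionalEquality
open import Relation.Nullary using (¬_; Dec; yes; no; does; contradiction)
open import Relation.Nullary.Decidable using (¬?; _×-dec_; _⊎-dec_; dec-true; dec-false; decidable-stable)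

private
  variable
    k l m n N q q′ : ℕ
    A A′ : Set

-- Pigeonhole principle and lists without repetition

unblocked : {R : Fin l → Fin k → Set} → (∀ i j → Dec (R i j)) →
  (∀ {i i′ j} → R i j → R i′ j → i ≡ i′) → k < l → ∃[ i ] ∀ j → ¬ R i j
unblocked {R = R} R? unique k<l with any? (λ i → all? (λ j → ¬? (R? i j)))
... | yes free = free
-- If every `i` were related to some `j`, choosing one for each would inject `Fin l` into the
-- smaller `Fin k`.
... | no ¬free = contradiction (injective⇒≤ blocker-injective) (ℕ.<⇒≱ k<l)
  where
  blocker : ∀ i → ∃ (R i)
  blocker i with any? (R? i)
  ... | yes b = b
  ... | no ¬b = contradiction (i , λ j r → ¬b (j , r)) ¬free

  blocker-injective : ∀ {i i′} → proj₁ (blocker i) ≡ proj₁ (blocker i′) → i ≡ i′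
  blocker-injective {i} {i′} eq =
    unique (proj₂ (blocker i)) (subst (R i′) (sym eq) (proj₂ (blocker i′)))

lookup-AllPairs : {R : A → A → Set} {xs : List A} → Symmetric R → AllPairs R xs →
  ∀ {i j} → i ≢ j → R (lookup xs i) (lookup xs j)
lookup-AllPairs R-sym (_  ∷ _)   {zero}  {zero}  i≢j = contradiction refl i≢j
lookup-AllPairs R-sym (px ∷ _)   {zero}  {suc j} i≢j = All.lookup px (∈-lookup j)
lookup-AllPairs R-sym (px ∷ _)   {suc i} {zero}  i≢j = R-sym (All.lookup px (∈-lookup i))
lookup-AllPairs R-sym (_  ∷ pxs) {suc i} {suc j} i≢j =
  lookup-AllPairs R-sym pxs (i≢j ∘ cong suc)

lookup-injective : {xs : List A} → Unique xs → ∀ {i j} → lookup xs i ≡ lookup xs j → i ≡ j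
lookup-injective unique {i} {j} eq with i Fin.≟ j
... | yes i≡j = i≡j
... | no i≢j  = contradiction eq (lookup-AllPairs (_∘ sym) unique i≢j)

-- Complements, neighbour lists and complex degree

adj⇒≢ : (G : Graph n) → ∀ {i j} → adj G i j ≡ true → i ≢ j
adj⇒≢ G {i} ij refl with () ← trans (sym ij) (adj-irrefl G i)

adj-complement : (G : Graph n) → ∀ {i j} → i ≢ j → adj (complement G) i j ≡ not (adj G i j)
adj-complement G {i} {j} i≢j =
  trans (cong (λ b → not (adj G i j) Bool.∧ not b) (dec-false (i Fin.≟ j) i≢j))
        (∧-identityʳ _)

complement-true : (G : Graph n) → ∀ {i j} → adj (complement G) i j ≡ true → adj G i j ≡ false
complement-true G {i} {j} ij = ¬-not λ eq → contradiction (begin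
  true                          ≡⟨ ij ⟨
  adj (complement G) i j        ≡⟨ adj-complement G (adj⇒≢ (complement G) ij) ⟩
  not (adj G i j)               ≡⟨ cong not eq ⟩
  false                         ∎) λ ()
  where open ≡-Reasoning

neighbourList : Graph n → Fin n → List (Fin n)
neighbourList G v = filter (λ u → adj G v u Bool.≟ true) (allFin _)

-- Stated for a general `f` so that the induction can pass to `f ∘ suc`.
length-filter-tabulate : (b : A → Bool) (f : Fin m → A) →
  length (filter (λ x → b x Bool.≟ true) (tabulate f)) ≡ ∣ Vec.tabulate (b ∘ f) ∣
length-filter-tabulate {m = zero} b f = refl
length-filter-tabulate {m = suc m}  b f with b (f zero)
... | true  = cong suc (length-filter-tabulate b (f ∘ suc))
... | false = length-filter-tabulate b (f ∘ suc)

length-neighbourList : (G : Graph n) (v : Fin n) → length (neighbourList G v) ≡ degree G v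
length-neighbourList G v = length-filter-tabulate (adj G v) id

∈-neighbourList⁺ : (G : Graph n) → ∀ {u v} → adj G v u ≡ true → u ∈ neighbourList G v
∈-neighbourList⁺ G {u} {v} = ∈-filter⁺ (λ w → adj G v w Bool.≟ true) (∈-allFin u)

∈-neighbourList⁻ : (G : Graph n) → ∀ {u v} → u ∈ neighbourList G v → adj G v u ≡ true
∈-neighbourList⁻ G {u} {v} = proj₂ ∘ ∈-filter⁻ (λ w → adj G v w Bool.≟ true) {xs = allFin _}

neighbourList-unique : (G : Graph n) (v : Fin n) → Unique (neighbourList G v)
neighbourList-unique G v = filter⁺ (λ u → adj G v u Bool.≟ true) (allFin⁺ _)

cd≤cΔ : (G : Graph n) (v : Fin n) → cd G v ≤ cΔ G
cd≤cΔ G v = All.lookup (xs≤max 0 _) (∈-map⁺ (cd G) (∈-allFin v))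

cΔ≤ : (G : Graph n) → (∀ v → cd G v ≤ k) → cΔ G ≤ k
cΔ≤ G bound = max≤v⁺ z≤n (map⁺ (tabulate⁺ bound))

-- Matchings and maximum matchings

NoSharedVertex-sym : Symmetric (NoSharedVertex {n})
NoSharedVertex-sym (i≢k , i≢l , j≢k , j≢l) = i≢k ∘ sym , j≢k ∘ sym , i≢l ∘ sym , j≢l ∘ sym

-- The edges are disjoint, so each `u a` lies on at most one of them; fewer vertices than edges
-- leave some edge untouched.
unusedEdge : {M : List (Fin n × Fin n)} → AllPairs NoSharedVertex M →
  (u : Fin k → Fin n) → k < length M →
  ∃[ i ] ∃[ j ] (i , j) ∈ M × (∀ a → u a ≢ i) × (∀ a → u a ≢ j)
unusedEdge {n} {M = M} disjoint u k<M =
  let a , free = unblocked hits? hits-unique k<M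
  in  _ , _ , ∈-lookup a , (λ b → free b ∘ inj₁) , (λ b → free b ∘ inj₂)
  where
  Hits : Fin (length M) → Fin _ → Set
  Hits a b = u b ≡ proj₁ (lookup M a) ⊎ u b ≡ proj₂ (lookup M a)

  hits? : ∀ a b → Dec (Hits a b)
  hits? a b = (u b Fin.≟ proj₁ (lookup M a)) ⊎-dec (u b Fin.≟ proj₂ (lookup M a))

  sharing : ∀ {e f : Fin n × Fin n} {w} → w ≡ proj₁ e ⊎ w ≡ proj₂ e → w ≡ proj₁ f ⊎ w ≡ proj₂ f →
    ¬ NoSharedVertex e f
  sharing (inj₁ p) (inj₁ q) (≢₁ , _) = ≢₁ (trans (sym p) q)
  sharing (inj₁ p) (inj₂ q) (_ , ≢₂ , _) = ≢₂ (trans (sym p) q)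
  sharing (inj₂ p) (inj₁ q) (_ , _ , ≢₃ , _) = ≢₃ (trans (sym p) q)
  sharing (inj₂ p) (inj₂ q) (_ , _ , _ , ≢₄) = ≢₄ (trans (sym p) q)

  hits-unique : ∀ {a a′ b} → Hits a b → Hits a′ b → a ≡ a′
  hits-unique {a} {a′} h h′ with a Fin.≟ a′
  ... | yes a≡a′ = a≡a′
  ... | no a≢a′  = contradiction (lookup-AllPairs NoSharedVertex-sym disjoint a≢a′) (sharing h h′)

[]∈sublists : (xs : List A) → [] ∈ sublists xs
[]∈sublists []       = here refl
[]∈sublists (x ∷ xs) = ∈-++⁺ʳ _ ([]∈sublists xs)

∈-sublist : (xs : List A) → ∀ {ys y} → ys ∈ sublists xs → y ∈ ys → y ∈ xs
∈-sublist []       (here refl) ()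
∈-sublist (x ∷ xs) ys∈ y∈ with ∈-++⁻ (map (x ∷_) (sublists xs)) ys∈
... | inj₂ ys∈xs = there (∈-sublist xs ys∈xs y∈)
... | inj₁ ys∈x∷xs with ∈-map⁻ (x ∷_) ys∈x∷xs
...   | zs , zs∈ , refl with y∈
...     | here refl = here refl
...     | there y∈zs = there (∈-sublist xs zs∈ y∈zs)

-- The new entry goes to its place in `xs` rather than to the front, so `y ∷ ys` is reached only up
-- to order.
sublists-insert : ∀ (xs : List A) {ys y} → ys ∈ sublists xs → y ∈ xs → y ∉ ys →
  ∃[ zs ] zs ∈ sublists xs × zs ↭ y ∷ ys
sublists-insert (x ∷ xs) ys∈ y∈ y∉ with ∈-++⁻ (map (x ∷_) (sublists xs)) ys∈ | y∈
... | inj₂ ys∈xs | here refl = _ , ∈-++⁺ˡ (∈-map⁺ (x ∷_) ys∈xs) , ↭-refl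
... | inj₂ ys∈xs | there y∈xs =
  let zs , zs∈ , zs↭ = sublists-insert xs ys∈xs y∈xs y∉ in zs , ∈-++⁺ʳ _ zs∈ , zs↭
... | inj₁ ys∈x∷xs | y∈x∷xs with ∈-map⁻ (x ∷_) ys∈x∷xs | y∈x∷xs
...   | ys′ , ys′∈ , refl | here refl  = contradiction (here refl) y∉
...   | ys′ , ys′∈ , refl | there y∈xs =
  let zs , zs∈ , zs↭ = sublists-insert xs ys′∈ y∈xs (y∉ ∘ there)
  in  x ∷ zs , ∈-++⁺ˡ (∈-map⁺ (x ∷_) zs∈) , ↭-trans (prep x zs↭) (↭-swap x _ ↭-refl)

module _ (G : Graph n) where

  ∈-edges⁺ : ∀ {i j} → i Fin.< j → adj G i j ≡ true → (i , j) ∈ edges G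
  ∈-edges⁺ {i} {j} i<j ij =
    ∈-filter⁺ _ (∈-cartesianProduct⁺ (∈-allFin i) (∈-allFin j)) (i<j , Equivalence.from T-≡ ij)

  ∈-edges⁻ : ∀ {e} → e ∈ edges G → adj G (proj₁ e) (proj₂ e) ≡ true
  ∈-edges⁻ e∈ =
    Equivalence.to T-≡ (proj₂ (proj₂ (∈-filter⁻ _ {xs = cartesianProduct (allFin n) (allFin n)} e∈)))

  ∈-matchings⁻ : ∀ {M} → M ∈ matchings G → M ∈ sublists (edges G) × AllPairs NoSharedVertex M
  ∈-matchings⁻ = ∈-filter⁻ (allPairs? noSharedVertex?)

  matching-edge : ∀ {M i j} → M ∈ matchings G → (i , j) ∈ M → adj G i j ≡ true
  matching-edge M∈ e∈ = ∈-edges⁻ (∈-sublist (edges G) (proj₁ (∈-matchings⁻ M∈)) e∈)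

  maximumMatching : ∃[ M ] M ∈ matchings G × length M ≡ μ G
  maximumMatching with argmax-sel id 0 (map length (matchings G))
  ... | inj₁ μ≡0 = [] , ∈-filter⁺ (allPairs? noSharedVertex?) ([]∈sublists (edges G)) [] , sym μ≡0
  ... | inj₂ μ∈  = let M , M∈ , eq = ∈-map⁻ length μ∈ in M , M∈ , sym eq

  -- An edge disjoint from all of `M` could be inserted, giving a matching of size `suc (μ G)`. The
  -- order of insertion is harmless because `NoSharedVertex` is symmetric.
  maximumMatching-meets : ∀ {M} → M ∈ matchings G → length M ≡ μ G →
    ∀ {e} → e ∈ edges G → Any (λ f → ¬ NoSharedVertex e f) M
  maximumMatching-meets {M} M∈ M≡μ {e} e∈ with All.all? (noSharedVertex? e) M
  ... | no ¬free = ¬All⇒Any¬ (noSharedVertex? e) M ¬free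
  ... | yes free =
    let M-sub , M-disjoint = ∈-matchings⁻ M∈
        M′ , M′-sub , M′↭  =
          -- An edge shares its ends with itself, so `e`, being disjoint from every edge of `M`, is
          -- not in `M`.
          sublists-insert (edges G) M-sub e∈ (λ e∈M → proj₁ (All.lookup free e∈M) refl)
        M′-disjoint        =
          Permutationₛ.AllPairs-resp-↭ (setoid _) NoSharedVertex-sym
            (subst (NoSharedVertex _) , subst (λ x → NoSharedVertex x _)) (↭⇒↭ₛ (↭-sym M′↭)) (free ∷ M-disjoint)
        M′∈                = ∈-filter⁺ (allPairs? noSharedVertex?) M′-sub M′-disjoint
        M′≤μ               = All.lookup (xs≤max 0 (map length (matchings G))) (∈-map⁺ length M′∈)
    in  contradiction (subst₂ _≤_ (trans (↭-length M′↭) (cong suc M≡μ)) refl M′≤μ) ℕ.1+n≰n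

  edge-meets : ∀ {M} → M ∈ matchings G → length M ≡ μ G → ∀ {i j} → adj G i j ≡ true →
    Any (λ f → ¬ NoSharedVertex (i , j) f) M
  edge-meets M∈ M≡μ {i} {j} ij with <-cmp i j
  ... | tri< i<j _ _ = maximumMatching-meets M∈ M≡μ (∈-edges⁺ i<j ij)
  ... | tri≈ _ i≡j _ = contradiction i≡j (adj⇒≢ G ij)
  ... | tri> _ _ j<i =
    -- `edges` lists this edge as `(j , i)`; sharing a vertex does not depend on the order of the
    -- ends.
    Any.map (λ ¬ns (a , b , c , d) → ¬ns (c , d , a , b))
      (maximumMatching-meets M∈ M≡μ (∈-edges⁺ j<i (trans (adj-sym G j i) ij)))

-- Split triples and shattered pairs

Splits : Graph n → (x y z : Fin n) → Set
Splits G x y z = adj G x y ≡ true × adj G x z ≡ false × x ≢ z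

separated : (G : Graph n) → ∀ {v x y} → adj G v x ≡ true → adj G v y ≡ false → x ≢ y
separated G vx vy refl with () ← trans (sym vx) vy

splits-≢ : (G : Graph n) → ∀ {x y z} → Splits G x y z → x ≢ y × x ≢ z × y ≢ z
splits-≢ G (xy , xz , x≢z) = adj⇒≢ G xy , x≢z , separated G xy xz

-- If `a` is `c`, it splits `b` from `d`. Otherwise the pair `a`, `c` decides: if it is a non-edge,
-- `a` splits `b` from `c`; if it is an edge, `c` splits `a` from `d`.
edge-nonedge⇒splits : (G : Graph n) (Q : Fin n → Set) → ∀ {a b c d} → Q a → Q b → Q c → Q d →
  adj G a b ≡ true → adj G c d ≡ false → c ≢ d →
  ∃[ x ] ∃[ y ] ∃[ z ] (Q x × Q y × Q z) × Splits G x y z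
edge-nonedge⇒splits G Q {a} {b} {c} {d} qa qb qc qd ab cd c≢d with a Fin.≟ c | adj G a c in ac
... | yes refl | _     = a , b , d , (qa , qb , qd) , ab , cd , c≢d
... | no a≢c   | false = a , b , c , (qa , qb , qc) , ab , ac , a≢c
... | no _     | true  = c , a , d , (qc , qa , qd) , trans (adj-sym G c a) ac , cd , c≢d

-- A single injection on `Fin s × Fin 3` says both that the triples are disjoint and that each has
-- three distinct members.
record SplitTriples (G : Graph n) (s : ℕ) : Set where
  field
    vertex    : Fin s × Fin 3 → Fin n
    injective : ∀ {p q} → vertex p ≡ vertex q → p ≡ q
    edge      : ∀ i → adj G (vertex (i , 0F)) (vertex (i , 1F)) ≡ true
    nonedge   : ∀ i → adj G (vertex (i , 0F)) (vertex (i , 2F)) ≡ false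

open SplitTriples

module _ {G : Graph n} {s : ℕ} (T : SplitTriples G s) {x y z : Fin n}
         (xyz : Splits G x y z)
         (x∉ : ∀ p → vertex T p ≢ x) (y∉ : ∀ p → vertex T p ≢ y) (z∉ : ∀ p → vertex T p ≢ z) where

  private
    newTriple : Fin 3 → Fin n
    newTriple 0F = x
    newTriple 1F = y
    newTriple 2F = z

    newTriple-injective : ∀ {a b} → newTriple a ≡ newTriple b → a ≡ b
    newTriple-injective {a} {b} = go a b (splits-≢ G xyz)
      where
      go : ∀ a b → x ≢ y × x ≢ z × y ≢ z → newTriple a ≡ newTriple b → a ≡ b
      go 0F 0F _ _ = refl
      go 0F 1F (x≢y , _ , _) eq = contradiction eq x≢y
      go 0F 2F (_ , x≢z , _) eq = contradiction eq x≢z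
      go 1F 0F (x≢y , _ , _) eq = contradiction (sym eq) x≢y
      go 1F 1F _ _ = refl
      go 1F 2F (_ , _ , y≢z) eq = contradiction eq y≢z
      go 2F 0F (_ , x≢z , _) eq = contradiction (sym eq) x≢z
      go 2F 1F (_ , _ , y≢z) eq = contradiction (sym eq) y≢z
      go 2F 2F _ _ = refl

    newTriple∉ : ∀ p a → vertex T p ≢ newTriple a
    newTriple∉ p 0F = x∉ p
    newTriple∉ p 1F = y∉ p
    newTriple∉ p 2F = z∉ p

    vertex′ : Fin (suc s) × Fin 3 → Fin n
    vertex′ (zero  , a) = newTriple a
    vertex′ (suc i , a) = vertex T (i , a)

    vertex′-injective : ∀ {p q} → vertex′ p ≡ vertex′ q → p ≡ q
    vertex′-injective {zero  , a} {zero  , b} eq = cong (zero ,_) (newTriple-injective eq)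
    vertex′-injective {zero  , a} {suc j , b} eq = contradiction (sym eq) (newTriple∉ (j , b) a)
    vertex′-injective {suc i , a} {zero  , b} eq = contradiction eq (newTriple∉ (i , a) b)
    vertex′-injective {suc i , a} {suc j , b} eq with injective T eq
    ... | refl = refl

  addTriple : SplitTriples G (suc s)
  addTriple .vertex = vertex′
  addTriple .injective = vertex′-injective
  addTriple .edge zero = proj₁ xyz
  addTriple .edge (suc i) = edge T i
  addTriple .nonedge zero = proj₁ (proj₂ xyz)
  addTriple .nonedge (suc i) = nonedge T i

-- Any edge and any non-edge off the vertices used so far contain a further split triple.
disjointSplitTriples : (G : Graph n) → ∀ {M M̄} → M ∈ matchings G → M̄ ∈ matchings (complement G) →
  ∀ s → s * 3 ≤ length M → s * 3 ≤ length M̄ → SplitTriples G s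
disjointSplitTriples G M∈ M̄∈ zero _ _ = record
  { vertex = λ () ; injective = λ { {()} } ; edge = λ () ; nonedge = λ () }
disjointSplitTriples {n} G {M} {M̄} M∈ M̄∈ (suc s) ≤M ≤M̄ =
  let a , b , ab∈ , a∉ , b∉ = unusedEdge (proj₂ (∈-matchings⁻ G M∈)) used (<of ≤M)
      c , d , cd∈ , c∉ , d∉ = unusedEdge (proj₂ (∈-matchings⁻ (complement G) M̄∈)) used (<of ≤M̄)
      cd = matching-edge (complement G) M̄∈ cd∈
      x , y , z , (x∉ , y∉ , z∉) , xyz =
        edge-nonedge⇒splits G (λ w → ∀ j → used j ≢ w) a∉ b∉ c∉ d∉
          (matching-edge G M∈ ab∈) (complement-true G cd) (adj⇒≢ (complement G) cd)
  in  addTriple T xyz (unused x∉) (unused y∉) (unused z∉)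
  where
  -- The earlier triples occupy `s * 3` vertices, fewer than the edges of either matching, so
  -- `unusedEdge` applies to both.
  <of : ∀ {l} → suc s * 3 ≤ l → s * 3 < l
  <of = ℕ.≤-trans (ℕ.m<n+m (s * 3) {3} z<s)

  T : SplitTriples G s
  T = disjointSplitTriples G M∈ M̄∈ s (ℕ.<⇒≤ (<of ≤M)) (ℕ.<⇒≤ (<of ≤M̄))

  used : Fin (s * 3) → Fin n
  used = vertex T ∘ remQuot 3

  unused : ∀ {w} → (∀ j → used j ≢ w) → ∀ p → vertex T p ≢ w
  unused w∉ p eq = w∉ (Inverse.from *↔× p) (trans (cong (vertex T) (Inverse.strictlyInverseˡ *↔× p)) eq)

-- The pairs `s i`, `t i` are fixed before the pattern `β`, so different patterns give different
-- labelled graphs on `Fin N`.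
Shatters : Graph n → ℕ → ℕ → Set
Shatters {n} G N m =
  Σ (Fin m → Fin N) λ s → Σ (Fin m → Fin N) λ t →
    (β : Fin m → Bool) → Σ (Fin N ↣ Fin n) λ f → ∀ i → adj (induced G f) (s i) (t i) ≡ β i

-- The `i`-th pair is `i` and `s + i`: the first goes to the apex of triple `i`, the second to its
-- neighbour or its non-neighbour as `β i` demands.
splitTriples⇒shatters : {G : Graph n} {s : ℕ} → SplitTriples G s → Shatters G (s + s) s
splitTriples⇒shatters {n} {G} {s} T = (_↑ˡ s) , (s ↑ʳ_) , λ β → mk↣ (embed-injective β) , pattern-correct β
  where
  choose : (Fin s → Bool) → Fin s ⊎ Fin s → Fin s × Fin 3
  choose β (inj₁ i) = i , 0F
  choose β (inj₂ i) = i , (if β i then 1F else 2F)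

  choose-injective : ∀ β {p q} → choose β p ≡ choose β q → p ≡ q
  choose-injective β {inj₁ i} {inj₁ j} eq = cong inj₁ (proj₁ (,-injective eq))
  choose-injective β {inj₁ i} {inj₂ j} eq with β j | eq
  ... | true  | ()
  ... | false | ()
  choose-injective β {inj₂ i} {inj₁ j} eq with β i | eq
  ... | true  | ()
  ... | false | ()
  choose-injective β {inj₂ i} {inj₂ j} eq = cong inj₂ (proj₁ (,-injective eq))

  embed : (Fin s → Bool) → Fin (s + s) → Fin n
  embed β = vertex T ∘ choose β ∘ splitAt s

  embed-injective : ∀ β {i j} → embed β i ≡ embed β j → i ≡ j
  embed-injective β = Injection.injective (↔⇒↣ +↔⊎) ∘ choose-injective β ∘ injective T

  pattern-correct : ∀ β i → adj G (embed β (i ↑ˡ s)) (embed β (s ↑ʳ i)) ≡ β i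
  pattern-correct β i rewrite splitAt-↑ˡ s i s | splitAt-↑ʳ s s i with β i
  ... | true  = edge T i
  ... | false = nonedge T i

-- Vertex `zero` goes to `v`, and `suc i` to the `i`-th neighbour or the `i`-th non-neighbour of
-- `v`, as `β i` demands. No vertex is of both sorts, so the map is injective.
cd⇒shatters : (G : Graph n) (v : Fin n) → m ≤ cd G v → Shatters G (suc m) m
cd⇒shatters {n} {m} G v m≤cd = (λ _ → zero) , suc , λ β → mk↣ (embed-injective β) , λ i → adj-pick (β i) i
  where
  m≤ : ∀ H → m ≤ degree H v → m ≤ length (neighbourList H v)
  m≤ H = subst (m ≤_) (sym (length-neighbourList H v))

  m≤d : m ≤ length (neighbourList G v)
  m≤d = m≤ G (ℕ.≤-trans m≤cd (ℕ.m⊓n≤m _ _))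

  m≤d̄ : m ≤ length (neighbourList (complement G) v)
  m≤d̄ = m≤ (complement G) (ℕ.≤-trans m≤cd (ℕ.m⊓n≤n (degree G v) _))

  pick : Bool → Fin m → Fin n
  pick true  i = lookup (neighbourList G v) (inject≤ i m≤d)
  pick false i = lookup (neighbourList (complement G) v) (inject≤ i m≤d̄)

  v≢pick : ∀ b i → v ≢ pick b i
  v≢pick true  i = adj⇒≢ G (∈-neighbourList⁻ G (∈-lookup (inject≤ i m≤d)))
  v≢pick false i = adj⇒≢ (complement G) (∈-neighbourList⁻ (complement G) (∈-lookup (inject≤ i m≤d̄)))

  adj-pick : ∀ b i → adj G v (pick b i) ≡ b
  adj-pick true  i = ∈-neighbourList⁻ G (∈-lookup (inject≤ i m≤d))
  adj-pick false i = complement-true G (∈-neighbourList⁻ (complement G) (∈-lookup (inject≤ i m≤d̄)))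

  pick-injective : ∀ b c {i j} → pick b i ≡ pick c j → i ≡ j
  pick-injective true  true  eq = inject≤-injective m≤d m≤d _ _ (lookup-injective (neighbourList-unique G v) eq)
  pick-injective false false eq =
    inject≤-injective m≤d̄ m≤d̄ _ _ (lookup-injective (neighbourList-unique (complement G) v) eq)
  pick-injective true  false {i} {j} eq = contradiction eq (separated G (adj-pick true i) (adj-pick false j))
  pick-injective false true  {i} {j} eq = contradiction (sym eq) (separated G (adj-pick true j) (adj-pick false i))

  embed : (Fin m → Bool) → Fin (suc m) → Fin n
  embed β zero    = v
  embed β (suc i) = pick (β i) i

  embed-injective : ∀ β {i j} → embed β i ≡ embed β j → i ≡ j
  embed-injective β {zero}  {zero}  eq = refl
  embed-injective β {zero}  {suc j} eq = contradiction eq (v≢pick (β j) j)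
  embed-injective β {suc i} {zero}  eq = contradiction (sym eq) (v≢pick (β i) i)
  embed-injective β {suc i} {suc j} eq = cong suc (pick-injective (β i) (β j) eq)

-- Exponential against polynomial growth

1+2r≤2^r : ∀ x → 1 + ((3 + x) + (3 + x)) ≤ 2 ^ (3 + x)
-- The inequality fails at exponent 2, so the induction starts at 3, where it reads `7 ≤ 8`.
1+2r≤2^r zero    = s≤s (s≤s (s≤s (s≤s (s≤s (s≤s (s≤s z≤n))))))
1+2r≤2^r (suc x) = begin
  1 + ((4 + x) + (4 + x))           ≡⟨ solve 1 (λ x → con 1 :+ ((con 4 :+ x) :+ (con 4 :+ x))
                                                := con 9 :+ (x :+ x)) refl x ⟩
  9 + (x + x)                       ≤⟨ ℕ.+-mono-≤ (ℕ.m≤m+n 9 5) (ℕ.m≤m+n (x + x) (x + x)) ⟩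
  14 + ((x + x) + (x + x))          ≡⟨ solve 1 (λ x → con 14 :+ ((x :+ x) :+ (x :+ x))
                                                := con 2 :* (con 1 :+ ((con 3 :+ x) :+ (con 3 :+ x)))) refl x ⟩
  2 * (1 + ((3 + x) + (3 + x)))     ≤⟨ ℕ.*-monoʳ-≤ 2 (1+2r≤2^r x) ⟩
  2 * 2 ^ (3 + x)                   ∎
  where open ℕ.≤-Reasoning; open +-*-Solver

-- The witness is t = 4 ^ r with r = 3 + n₀ + a.
exponential-beats-polynomial : ∀ n₀ a → ∃[ t ] 0 < t × n₀ ≤ t + t × (t + t) ^ a < 2 ^ t
exponential-beats-polynomial n₀ a = 2 ^ s , ℕ.m^n>0 2 s , n₀≤ , power-<
  where
  open ℕ.≤-Reasoning
  r s : ℕ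
  r = 3 + (n₀ + a)
  s = r + r

  s<2^r : s < 2 ^ r
  s<2^r = 1+2r≤2^r (n₀ + a)

  a<2^r : a < 2 ^ r
  a<2^r = begin-strict
    a                ≤⟨ ℕ.m≤n+m a n₀ ⟩
    n₀ + a           ≤⟨ ℕ.m≤n+m (n₀ + a) 3 ⟩
    r                ≤⟨ ℕ.m≤m+n r r ⟩
    s                <⟨ s<2^r ⟩
    2 ^ r            ∎

  -- `(2 ^ s + 2 ^ s) ^ a` is 2 to the power `suc s * a`, so comparing exponents suffices; `suc s`
  -- and `suc a` are both at most `2 ^ r`.
  exponent-< : suc s * a < 2 ^ s
  exponent-< = begin-strict
    suc s * a        <⟨ ℕ.*-monoʳ-< (suc s) (ℕ.n<1+n a) ⟩
    suc s * suc a    ≤⟨ ℕ.*-mono-≤ s<2^r a<2^r ⟩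
    2 ^ r * 2 ^ r    ≡⟨ ℕ.^-distribˡ-+-* 2 r r ⟨
    2 ^ s            ∎

  n₀≤ : n₀ ≤ 2 ^ s + 2 ^ s
  n₀≤ = begin
    n₀               ≤⟨ ℕ.m≤m+n n₀ a ⟩
    n₀ + a           ≤⟨ ℕ.m≤n+m (n₀ + a) 3 ⟩
    r                ≤⟨ ℕ.m≤m+n r r ⟩
    s                ≤⟨ ℕ.<⇒≤ s<2^r ⟩
    2 ^ r            ≤⟨ ℕ.^-monoʳ-≤ 2 (ℕ.m≤m+n r r) ⟩
    2 ^ s            ≤⟨ ℕ.m≤m+n _ _ ⟩
    2 ^ s + 2 ^ s    ∎

  power-< : (2 ^ s + 2 ^ s) ^ a < 2 ^ (2 ^ s)
  power-< = begin-strict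
    (2 ^ s + 2 ^ s) ^ a  ≡⟨ cong (λ u → (2 ^ s + u) ^ a) (ℕ.+-identityʳ (2 ^ s)) ⟨
    (2 ^ suc s) ^ a      ≡⟨ ℕ.^-*-assoc 2 (suc s) a ⟩
    2 ^ (suc s * a)      <⟨ ℕ.^-monoʳ-< 2 (s<s z<s) exponent-< ⟩
    2 ^ (2 ^ s)          ∎

-- Injections into finite sets

finToFun-injective : ∀ m {x y : Fin (n ^ m)} → (∀ i → finToFun x i ≡ finToFun y i) → x ≡ y
finToFun-injective {n} m {x} {y} eq = begin
  x                       ≡⟨ funToFin-finToFin {m} {n} x ⟨
  funToFin (finToFun {n} {m} x)   ≡⟨ funToFin-cong m eq ⟩
  funToFin (finToFun {n} {m} y)   ≡⟨ funToFin-finToFin {m} {n} y ⟩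
  y                       ∎
  where
  open ≡-Reasoning
  funToFin-cong : ∀ m {f g : Fin m → Fin n} → (∀ i → f i ≡ g i) → funToFin f ≡ funToFin g
  funToFin-cong zero    f≗g = refl
  funToFin-cong (suc m) f≗g = cong₂ combine (f≗g zero) (funToFin-cong m (f≗g ∘ suc))

_×↣_ : A ↣ Fin q → A′ ↣ Fin q′ → (A × A′) ↣ Fin (q * q′)
f ×↣ g = mk↣ λ { {a , b} {c , d} eq →
  let fa≡fc , gb≡gd = combine-injective (Injection.to f a) _ (Injection.to f c) _ eq
  in  cong₂ _,_ (Injection.injective f fa≡fc) (Injection.injective g gb≡gd) }

vec↣ : A ↣ Fin q → ∀ m → Vec A m ↣ Fin (q ^ m)
vec↣ f zero    = mk↣ {to = λ _ → zero} λ { {[]} {[]} _ → refl }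
vec↣ f (suc m) = mk↣ {to = λ { (x ∷ xs) → combine (Injection.to f x) (Injection.to (vec↣ f m) xs) }}
  λ { {x ∷ xs} {y ∷ ys} eq →
    let fx≡fy , eq′ = combine-injective (Injection.to f x) _ (Injection.to f y) _ eq
    in  cong₂ _∷_ (Injection.injective f fx≡fy) (Injection.injective (vec↣ f m) eq′) }

-- Describing a graph by a short code

pad : (xs : List A) → length xs ≤ m → (d : A) →
  Σ (Vec A m) λ v → (∀ {x} → x ∈ xs → x ∈ᵥ v) × (∀ {x} → x ∈ᵥ v → x ∈ xs ⊎ x ≡ d)
-- The default `d` fills the free places, so it may occur in the vector without being in `xs`.
pad {m = m} [] _ d = Vec.replicate m d , (λ ()) , inj₂ ∘ replicate⁻ m
  where
  replicate⁻ : ∀ m {x} → x ∈ᵥ Vec.replicate m d → x ≡ d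
  replicate⁻ (suc m) (here eq)  = eq
  replicate⁻ (suc m) (there x∈) = replicate⁻ m x∈
pad (y ∷ xs) (s≤s xs≤m) d =
  let v , to , from = pad xs xs≤m d
  in  y ∷ v
    , (λ { (here eq) → here eq ; (there x∈) → there (to x∈) })
    , λ { (here eq) → inj₁ (here eq) ; (there x∈) → Sum.map₁ there (from x∈) }

-- A vertex, whether its non-neighbours (rather than its neighbours) are listed, and the list.
NbhdCode : ℕ → ℕ → Set
NbhdCode n k = Fin n × Bool × Vec (Fin n) k

-- Nothing is said about `v` itself, because the vector may be padded with `v`.
DescribesNbhd : Graph n → NbhdCode n k → Set
DescribesNbhd G (v , τ , w) = ∀ {u} → u ≢ v → adj G v u ≡ τ xor does (_∈?_ Fin._≟_ u w)

neighbourVec : (G : Graph n) (v : Fin n) → degree G v ≤ k →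
  Σ (Vec (Fin n) k) λ w → DescribesNbhd G (v , false , w)
neighbourVec G v d≤k =
  let w , to , from = pad (neighbourList G v) (subst (_≤ _) (sym (length-neighbourList G v)) d≤k) v
  in  w , describes w to from
  where
  describes : (w : Vec _ _) → (∀ {u} → u ∈ neighbourList G v → u ∈ᵥ w) →
    (∀ {u} → u ∈ᵥ w → u ∈ neighbourList G v ⊎ u ≡ v) → DescribesNbhd G (v , false , w)
  describes w to from {u} u≢v with _∈?_ Fin._≟_ u w
  ... | no u∉w  = ¬-not (u∉w ∘ to ∘ ∈-neighbourList⁺ G)
  ... | yes u∈w with from u∈w
  ...   | inj₁ u∈N = ∈-neighbourList⁻ G u∈N
  ...   | inj₂ u≡v = contradiction u≡v u≢v

-- The smaller of the two degrees of `v` is at most `k`, so its neighbours in `G` or in the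
-- complement can be listed; the flag records which.
nbhdCode : (G : Graph n) (v : Fin n) → cd G v ≤ k →
  Σ (NbhdCode n k) λ e → proj₁ e ≡ v × DescribesNbhd G e
nbhdCode {k = k} G v cd≤k with ℕ.⊓-sel (degree G v) (degree (complement G) v)
... | inj₁ cd≡d =
  let w , describes = neighbourVec G v (subst (_≤ k) cd≡d cd≤k) in (v , false , w) , refl , describes
... | inj₂ cd≡d̄ =
  let w , describes = neighbourVec (complement G) v (subst (_≤ k) cd≡d̄ cd≤k)
  in  (v , true , w) , refl , λ {u} u≢v → begin
        adj G v u                      ≡⟨ not-involutive _ ⟨
        not (not (adj G v u))          ≡⟨ cong not (adj-complement G (u≢v ∘ sym)) ⟨
        not (adj (complement G) v u)   ≡⟨ cong not (describes u≢v) ⟩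
        not (does (_∈?_ Fin._≟_ u w))  ∎
  where open ≡-Reasoning

endpoints : List (Fin n × Fin n) → List (Fin n)
endpoints []            = []
endpoints ((i , j) ∷ M) = i ∷ j ∷ endpoints M

length-endpoints : (M : List (Fin n × Fin n)) → length (endpoints M) ≡ length M + length M
length-endpoints []      = refl
length-endpoints (_ ∷ M) =
  cong suc (trans (cong suc (length-endpoints M)) (sym (ℕ.+-suc (length M) (length M))))

meets⇒∈-endpoints : (M : List (Fin n × Fin n)) → ∀ {i j} →
  Any (λ f → ¬ NoSharedVertex (i , j) f) M → i ∈ endpoints M ⊎ j ∈ endpoints M
meets⇒∈-endpoints (_ ∷ M) (there meets) =
  Sum.map (λ i∈ → there (there i∈)) (λ j∈ → there (there j∈)) (meets⇒∈-endpoints M meets)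
meets⇒∈-endpoints ((a , b) ∷ M) {i} {j} (here ¬disjoint)
  with i Fin.≟ a | i Fin.≟ b | j Fin.≟ a | j Fin.≟ b
... | yes i≡a | _ | _ | _ = inj₁ (here i≡a)
... | no _ | yes i≡b | _ | _ = inj₁ (there (here i≡b))
... | no _ | no _ | yes j≡a | _ = inj₂ (here j≡a)
... | no _ | no _ | no _ | yes j≡b = inj₂ (there (here j≡b))
... | no i≢a | no i≢b | no j≢a | no j≢b = contradiction (i≢a , i≢b , j≢a , j≢b) ¬disjoint

-- The endpoints of a maximum matching meet every edge, and there are at most `k + k` of them; `d`
-- fills the remaining places.
vertexCover : (G : Graph n) → μ G ≤ k → Fin n →
  Σ (Vec (Fin n) (k + k)) λ C → ∀ {i j} → adj G i j ≡ true → i ∈ᵥ C ⊎ j ∈ᵥ C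
vertexCover {k = k} G μ≤k d =
  let M , M∈ , M≡μ = maximumMatching G
      M≤k          = subst (_≤ k) (sym M≡μ) μ≤k
      C , to , _   = pad (endpoints M) (subst (_≤ k + k) (sym (length-endpoints M)) (ℕ.+-mono-≤ M≤k M≤k)) d
  in  C , λ ij → Sum.map to to (meets⇒∈-endpoints M (edge-meets G M∈ M≡μ ij))

-- The neighbourhoods of the vertices of a cover, and the adjacency of all other pairs.
Code : ℕ → ℕ → Set
Code n k = Bool × Vec (NbhdCode n k) (k + k)

Covers : Vec (NbhdCode n k) m → Fin n → Set
Covers c i = ∃[ l ] proj₁ (Vec.lookup c l) ≡ i

covers? : (c : Vec (NbhdCode n k) m) (i : Fin n) → Dec (Covers c i)
covers? c i = any? (λ l → proj₁ (Vec.lookup c l) Fin.≟ i)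

record Describes (G : Graph n) (c : Code n k) : Set where
  field
    covered   : ∀ l → DescribesNbhd G (Vec.lookup (proj₂ c) l)
    uncovered : ∀ {i j} → i ≢ j → ¬ Covers (proj₂ c) i → ¬ Covers (proj₂ c) j → adj G i j ≡ proj₁ c

open Describes

-- A pair with a covered end is settled by the code of that end, any other pair by the common value
-- `proj₁ c`. Hence codes bound the number of graphs.
describes-unique : {G H : Graph n} {c : Code n k} → Describes G c → Describes H c →
  ∀ i j → adj G i j ≡ adj H i j
describes-unique {G = G} {H} {c} dG dH i j with i Fin.≟ j
... | yes refl = trans (adj-irrefl G i) (sym (adj-irrefl H i))
... | no i≢j with covers? (proj₂ c) i | covers? (proj₂ c) j
...   | no i∉          | no j∉          = trans (uncovered dG i≢j i∉ j∉) (sym (uncovered dH i≢j i∉ j∉))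
...   | yes (l , refl) | _              = trans (covered dG l (i≢j ∘ sym)) (sym (covered dH l (i≢j ∘ sym)))
...   | no _           | yes (l , refl) = begin
  adj G i j   ≡⟨ adj-sym G i j ⟩
  adj G j i   ≡⟨ trans (covered dG l i≢j) (sym (covered dH l i≢j)) ⟩
  adj H j i   ≡⟨ adj-sym H j i ⟩
  adj H i j   ∎
  where open ≡-Reasoning

module _ (G : Graph n) (cΔ≤k : cΔ G ≤ k) where

  private
    describeNbhd : (v : Fin n) → Σ (NbhdCode n k) λ e → proj₁ e ≡ v × DescribesNbhd G e
    describeNbhd v = nbhdCode G v (ℕ.≤-trans (cd≤cΔ G v) cΔ≤k)

  -- `σ` is the adjacency of all pairs off the cover: `false` for a vertex cover of `G`, `true` for
  -- one of its complement.
  describe-cover : ∀ σ (C : Vec (Fin n) (k + k)) →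
    (∀ {i j} → i ≢ j → adj G i j ≢ σ → i ∈ᵥ C ⊎ j ∈ᵥ C) → ∃ (Describes {k = k} G)
  describe-cover σ C cover = (σ , c) , record
    { covered   = λ l →
        subst (DescribesNbhd G) (sym (lookup-c l)) (proj₂ (proj₂ (describeNbhd (Vec.lookup C l))))
    ; uncovered = λ {i} {j} i≢j i∉ j∉ → decidable-stable (adj G i j Bool.≟ σ)
        (λ ij≢σ → Sum.[ i∉ ∘ ∈⇒covers , j∉ ∘ ∈⇒covers ] (cover i≢j ij≢σ))
    }
    where
    c : Vec (NbhdCode n k) (k + k)
    c = Vec.map (proj₁ ∘ describeNbhd) C

    lookup-c : ∀ l → Vec.lookup c l ≡ proj₁ (describeNbhd (Vec.lookup C l))
    lookup-c l = Vec.lookup-map l (proj₁ ∘ describeNbhd) C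

    ∈⇒covers : ∀ {i} → i ∈ᵥ C → Covers c i
    ∈⇒covers i∈ = index i∈ ,
      trans (cong proj₁ (lookup-c (index i∈)))
            (trans (proj₁ (proj₂ (describeNbhd _))) (sym (Anyᵥ.lookup-index i∈)))

  describe : cμ G ≤ k → Fin n → ∃ (Describes {k = k} G)
  describe cμ≤k d with ℕ.⊓-sel (μ G) (μ (complement G))
  ... | inj₁ cμ≡μ =
    let C , cover = vertexCover G (subst (_≤ k) cμ≡μ cμ≤k) d
    in  describe-cover false C (λ _ ij≢ → cover (¬-not ij≢))
  ... | inj₂ cμ≡μ̄ =
    let C , cover = vertexCover (complement G) (subst (_≤ k) cμ≡μ̄ cμ≤k) d
    in  describe-cover true C (λ i≢j ij≢ → cover (trans (adj-complement G i≢j) (cong not (¬-not ij≢))))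

codeCount : ℕ → ℕ → ℕ
codeCount n k = 2 * (n * (2 * n ^ k)) ^ (k + k)

code↣ : ∀ n k → Code n k ↣ Fin (codeCount n k)
code↣ n k = bool↣ ×↣ vec↣ (mk↣ {to = id} id ×↣ (bool↣ ×↣ vec↣ (mk↣ {to = id} id) k)) (k + k)
  where
  bool↣ : Bool ↣ Fin 2
  bool↣ = ↔⇒↣ (↔-sym 2↔Bool)

-- Each factor 2 is replaced by `n`, which makes the whole product a power of `n`.
codeCount≤ : ∀ n k → 2 ≤ n → codeCount n k ≤ n ^ suc ((2 + k) * (k + k))
codeCount≤ n k 2≤n = begin
  2 * (n * (2 * n ^ k)) ^ (k + k)   ≤⟨ ℕ.*-mono-≤ 2≤n (ℕ.^-monoˡ-≤ (k + k) (ℕ.*-monoʳ-≤ n (ℕ.*-monoˡ-≤ (n ^ k) 2≤n))) ⟩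
  n * (n ^ (2 + k)) ^ (k + k)       ≡⟨ cong (n *_) (ℕ.^-*-assoc n (2 + k) (k + k)) ⟩
  n ^ suc ((2 + k) * (k + k))       ∎
  where open ℕ.≤-Reasoning

-- Transpositions and homogeneous graphs

transpose-fixes : ∀ {a b c : Fin n} → c ≢ a → c ≢ b → Components.transpose a b c ≡ c
transpose-fixes {a = a} {b} {c} c≢a c≢b
  rewrite dec-false (c Fin.≟ a) c≢a | dec-false (c Fin.≟ b) c≢b = refl

transpose-second : ∀ (a b : Fin n) → Components.transpose a b b ≡ a
transpose-second a b with b Fin.≟ a
... | yes b≡a = b≡a
... | no _ rewrite dec-true (b Fin.≟ b) refl = refl

HasSplit : Graph n → Set
HasSplit G = ∃[ v ] ∃[ x ] ∃[ y ] Splits G v x y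

-- Without a split, adjacency to a fixed vertex is constant on the others. Changing one end at a
-- time then leads from any pair to the pair `zero`, `suc zero`.
¬split⇒homogeneous : (G : Graph (2 + n)) → ¬ HasSplit G →
  ∀ {i j} → i ≢ j → adj G i j ≡ adj G zero (suc zero)
¬split⇒homogeneous {n} G ¬split = go
  where
  same : ∀ {v x y} → v ≢ x → v ≢ y → adj G v x ≡ adj G v y
  same {v} {x} {y} v≢x v≢y with adj G v x in vx | adj G v y in vy
  ... | true  | true  = refl
  ... | false | false = refl
  ... | true  | false = contradiction (v , x , y , vx , vy , v≢y) ¬split
  ... | false | true  = contradiction (v , y , x , vy , vx , v≢x) ¬split

  go : ∀ {i j} → i ≢ j → adj G i j ≡ adj G zero (suc zero)
  go {zero}  {j} 0≢j = same 0≢j λ ()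
  go {suc i} {j} i≢j = begin
    adj G (suc i) j        ≡⟨ same i≢j (λ ()) ⟩
    adj G (suc i) zero     ≡⟨ adj-sym G (suc i) zero ⟩
    adj G zero (suc i)     ≡⟨ same (λ ()) (λ ()) ⟩
    adj G zero (suc zero)  ∎
    where open ≡-Reasoning

-- Counting the labelled members of a hereditary class

module Speed {ℓ : Level} (P : GraphClass ℓ) (hereditary : Hereditary P)
             (p : ℕ → ℕ) (speed : IsSpeed P p) where

  graph : Fin (p n) → Graph n
  graph x = proj₁ (Inverse.to (speed _) x)

  graph∈ : (x : Fin (p n)) → P n (graph x)
  graph∈ x = proj₂ (Inverse.to (speed _) x)

  number : (G : Graph n) → P n G → Fin (p n)
  number G G∈ = Inverse.from (speed _) (G , G∈)

  graph-number : (G : Graph n) (G∈ : P n G) → ∀ i j → adj (graph (number G G∈)) i j ≡ adj G i j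
  graph-number G G∈ = Inverse.strictlyInverseˡ (speed _) (G , G∈)

  graph-injective : ∀ {x y : Fin (p n)} → (∀ i j → adj (graph x) i j ≡ adj (graph y) i j) → x ≡ y
  graph-injective {n} {x} {y} eq = begin
    x                                                 ≡⟨ Inverse.strictlyInverseʳ (speed n) x ⟨
    Inverse.from (speed n) (Inverse.to (speed n) x)   ≡⟨ Inverse.from-cong (speed n) eq ⟩
    Inverse.from (speed n) (Inverse.to (speed n) y)   ≡⟨ Inverse.strictlyInverseʳ (speed n) y ⟩
    y                                                 ∎
    where open ≡-Reasoning

  inducedNumber : (G : Graph n) → P n G → Fin m ↣ Fin n → Fin (p m)
  inducedNumber G G∈ f = number (induced G f) (hereditary G f G∈)

  inducedNumber-injective : (G : Graph n) (G∈ : P n G) (f g : Fin m ↣ Fin n) →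
    inducedNumber G G∈ f ≡ inducedNumber G G∈ g → ∀ i j → adj (induced G f) i j ≡ adj (induced G g) i j
  inducedNumber-injective G G∈ f g eq i j = begin
    adj (induced G f) i j                    ≡⟨ graph-number _ (hereditary G f G∈) i j ⟨
    adj (graph (inducedNumber G G∈ f)) i j   ≡⟨ cong (λ x → adj (graph x) i j) eq ⟩
    adj (graph (inducedNumber G G∈ g)) i j   ≡⟨ graph-number _ (hereditary G g G∈) i j ⟩
    adj (induced G g) i j                    ∎
    where open ≡-Reasoning

  -- By heredity each pattern yields a member on `N` vertices, and the pattern can be read off from
  -- that member.
  shatters⇒2^≤ : {G : Graph n} → P n G → Shatters G N m → 2 ^ m ≤ p N
  shatters⇒2^≤ {n = n} {N = N} {m = m} {G} G∈ (s , t , realise) =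
    injective⇒≤ {f = inducedNumber G G∈ ∘ embedding} λ {x} {y} eq →
      finToFun-injective m λ i → Injection.injective (↔⇒↣ 2↔Bool) (begin
        bits x i                                   ≡⟨ proj₂ (realise (bits x)) i ⟨
        adj (induced G (embedding x)) (s i) (t i)  ≡⟨ inducedNumber-injective G G∈ (embedding x) (embedding y) eq (s i) (t i) ⟩
        adj (induced G (embedding y)) (s i) (t i)  ≡⟨ proj₂ (realise (bits y)) i ⟩
        bits y i                                   ∎)
    where
    open ≡-Reasoning
    bits : Fin (2 ^ m) → Fin m → Bool
    bits x i = Inverse.to 2↔Bool (finToFun x i)

    embedding : Fin (2 ^ m) → Fin N ↣ Fin n
    embedding x = proj₁ (realise (bits x))

  -- Slow growth bounds both parameters

  module _ {t : ℕ} (slow : p (suc t + suc t) < 2 ^ suc t) {G : Graph n} (G∈ : P n G) where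

    -- Of `suc t + suc t` vertices one stands for `v`, which leaves `t + suc t` for its neighbours
    -- and non-neighbours.
    slow⇒cΔ≤ : cΔ G ≤ t + suc t
    slow⇒cΔ≤ = cΔ≤ G λ v → ℕ.≮⇒≥ λ large →
      ℕ.<⇒≱ slow (begin
        2 ^ suc t              ≤⟨ ℕ.^-monoʳ-≤ 2 (ℕ.m≤n+m (suc t) t) ⟩
        2 ^ (t + suc t)        ≤⟨ shatters⇒2^≤ G∈ (cd⇒shatters G v (ℕ.<⇒≤ large)) ⟩
        p (suc t + suc t)      ∎)
      where open ℕ.≤-Reasoning

    -- Matchings of size `suc t * 3` on both sides give `suc t` split triples, which shatter `suc t`
    -- pairs on `suc t + suc t` vertices.
    slow⇒cμ≤ : cμ G ≤ suc t * 3
    slow⇒cμ≤ = ℕ.≮⇒≥ λ large →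
      let M , M∈ , M≡μ = maximumMatching G
          M̄ , M̄∈ , M̄≡μ̄ = maximumMatching (complement G)
          ≤M = subst (suc t * 3 ≤_) (sym M≡μ) (ℕ.≤-trans (ℕ.<⇒≤ large) (ℕ.m⊓n≤m _ _))
          ≤M̄ = subst (suc t * 3 ≤_) (sym M̄≡μ̄) (ℕ.≤-trans (ℕ.<⇒≤ large) (ℕ.m⊓n≤n (μ G) _))
      in  ℕ.<⇒≱ slow (shatters⇒2^≤ G∈ (splitTriples⇒shatters (disjointSplitTriples G M∈ M̄∈ (suc t) ≤M ≤M̄)))

  polynomial⇒bounded : PolynomialSpeed p → ∃[ k ] ∀ {n} (G : Graph n) → P n G → cΔ G ≤ k × cμ G ≤ k
  polynomial⇒bounded (_ , _ , a , suc b , _ , n₀ , poly)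
    with exponential-beats-polynomial n₀ a
  ... | suc t , _ , n₀≤N , N^a<2^t =
    (t + suc t) ⊔ suc t * 3 , λ G G∈ →
      ℕ.≤-trans (slow⇒cΔ≤ slow G∈) (ℕ.m≤m⊔n _ _) , ℕ.≤-trans (slow⇒cμ≤ slow G∈) (ℕ.m≤n⊔m (t + suc t) _)
    where
    -- The exponent of `p n` is positive, so a bound on `p n ^ suc b` is also one on `p n`.
    m≤m^suc : ∀ m → m ≤ m ^ suc b
    m≤m^suc zero      = z≤n
    m≤m^suc m@(suc _) = ℕ.m≤m*n m (m ^ b) ⦃ ℕ.m^n≢0 m b ⦄

    slow : p (suc t + suc t) < 2 ^ suc t
    slow = ℕ.≤-<-trans (ℕ.≤-trans (m≤m^suc _) (proj₂ (poly _ n₀≤N))) N^a<2^t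

  -- Upper and lower bounds on the speed

  bounded⇒≤codeCount : (∀ {n} (G : Graph n) → P n G → cΔ G ≤ k × cμ G ≤ k) → Fin n → p n ≤ codeCount n k
  bounded⇒≤codeCount {k} {n} bounded d =
    injective⇒≤ {f = λ x → Injection.to (code↣ n k) (proj₁ (description x))} λ {x} {y} eq →
      graph-injective (describes-unique (proj₂ (description x))
        (subst (Describes (graph y)) (sym (Injection.injective (code↣ n k) eq)) (proj₂ (description y))))
    where
    description : (x : Fin (p n)) → ∃ (Describes {k = k} (graph x))
    description x =
      let cΔ≤k , cμ≤k = bounded (graph x) (graph∈ x) in describe (graph x) cΔ≤k cμ≤k d

  -- For z = x, y let s ↦ G^(z s) be G with z and s exchanged (G itself if s = v).  From the
  -- pair (G^(x s) , G^(y s)) one recovers s: in exactly one of the two the adjacency of v and s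
  -- is flipped, whereas a t ≠ s keeps its adjacency to v in G^(z s) unless t = z.
  module _ {G : Graph n} (G∈ : P n G) {v x y : Fin n} (vxy : Splits G v x y) where

    private
      target : Fin n → Fin n → Fin n
      target z s with s Fin.≟ v
      ... | yes _ = z
      ... | no _  = s

      target-≢v : ∀ {z} → v ≢ z → ∀ s → v ≢ target z s
      target-≢v v≢z s with s Fin.≟ v
      ... | yes _   = v≢z
      ... | no s≢v  = s≢v ∘ sym

      target-avoids : ∀ {z s t} → t ≢ z → t ≢ s → t ≢ target z s
      target-avoids {s = s} t≢z t≢s with s Fin.≟ v
      ... | yes _ = t≢z
      ... | no _  = t≢s

      target-id : ∀ {z t} → t ≢ v → target z t ≡ t
      target-id {t = t} t≢v with t Fin.≟ v
      ... | yes t≡v = contradiction t≡v t≢v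
      ... | no _    = refl

      swap : Fin n → Fin n → Fin n ↣ Fin n
      swap z s = ↔⇒↣ (transpose z (target z s))

      adj-swap : ∀ {z} → v ≢ z → ∀ s t →
        adj (induced G (swap z s)) v t ≡ adj G v (Components.transpose z (target z s) t)
      adj-swap {z} v≢z s t =
        cong (λ w → adj G w (Components.transpose z (target z s) t)) (transpose-fixes v≢z (target-≢v v≢z s))

      -- For `t ≢ z`, exchanging `z` and `s` leaves `t` its adjacency to `v`, while exchanging `z`
      -- and `t` gives it that of `z`; equal results make the two agree.
      swap-separates : ∀ {z s t} → v ≢ z → s ≢ t → t ≢ v →
        inducedNumber G G∈ (swap z s) ≡ inducedNumber G G∈ (swap z t) → adj G v t ≡ adj G v z
      swap-separates {z} {s} {t} v≢z s≢t t≢v eq with t Fin.≟ z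
      ... | yes t≡z = cong (adj G v) t≡z
      ... | no t≢z  = begin
        adj G v t                                         ≡⟨ cong (adj G v) (transpose-fixes t≢z (target-avoids t≢z (s≢t ∘ sym))) ⟨
        adj G v (Components.transpose z (target z s) t)   ≡⟨ adj-swap v≢z s t ⟨
        adj (induced G (swap z s)) v t                    ≡⟨ inducedNumber-injective G G∈ (swap z s) (swap z t) eq v t ⟩
        adj (induced G (swap z t)) v t                    ≡⟨ adj-swap v≢z t t ⟩
        adj G v (Components.transpose z (target z t) t)   ≡⟨ cong (λ w → adj G v (Components.transpose z w t)) (target-id t≢v) ⟩
        adj G v (Components.transpose z t t)              ≡⟨ cong (adj G v) (transpose-second z t) ⟩
        adj G v z                                         ∎
        where open ≡-Reasoning

      code : Fin n → Fin (p n * p n)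
      code s = combine (inducedNumber G G∈ (swap x s)) (inducedNumber G G∈ (swap y s))

      code-separates : ∀ {s t} → s ≢ t → t ≢ v → code s ≢ code t
      code-separates {s} {t} s≢t t≢v eq =
        let eqˣ , eqʸ     = combine-injective _ _ (inducedNumber G G∈ (swap x t)) _ eq
            vx , vy , v≢y = vxy
            vt≡vx         = swap-separates (adj⇒≢ G vx) s≢t t≢v eqˣ
            vt≡vy         = swap-separates v≢y s≢t t≢v eqʸ
        -- `t` would be adjacent to `v` like `x` and non-adjacent to `v` like `y`.
        in  separated G (trans vt≡vx vx) (trans vt≡vy vy) refl

      -- `code-separates` asks that its second vertex differ from `v`; of two distinct vertices at
      -- least one does.
      code-injective : ∀ {s t} → code s ≡ code t → s ≡ t
      code-injective {s} {t} eq = decidable-stable (s Fin.≟ t) λ s≢t →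
        let t≡v = decidable-stable (t Fin.≟ v) λ t≢v → code-separates s≢t t≢v eq
        in  code-separates (s≢t ∘ sym) (λ s≡v → s≢t (trans s≡v (sym t≡v))) (sym eq)

    split⇒≤square : n ≤ p n * p n
    split⇒≤square = injective⇒≤ code-injective

  -- Members with a split, and constant speed

  SplitMember : ℕ → Set
  SplitMember n = Σ (Fin (p n)) λ x → HasSplit (graph x)

  splitMember? : ∀ n → Dec (SplitMember n)
  splitMember? n = any? λ g → any? λ v → any? λ x → any? λ y →
    (adj (graph g) v x Bool.≟ true) ×-dec (adj (graph g) v y Bool.≟ false) ×-dec ¬? (v Fin.≟ y)

  -- Among at least four vertices some `w` avoids `v`, `x` and `y`; deleting it keeps the split, and
  -- heredity keeps membership.
  splitMember-pred : 3 ≤ n → SplitMember (suc n) → SplitMember n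
  splitMember-pred {n} 3≤n (g , v , x , y , (vx , vy , v≢y)) =
    number G′ G′∈ , punchOut w≢v , punchOut w≢x , punchOut w≢y ,
      trans (adj-G′ w≢v w≢x) vx , trans (adj-G′ w≢v w≢y) vy , v≢y ∘ punchOut-injective w≢v w≢y
    where
    vertices : Fin 3 → Fin (suc n)
    vertices = Vec.lookup (v ∷ x ∷ y ∷ [])

    other : ∃[ w ] ∀ j → vertices j ≢ w
    other = unblocked {R = λ w j → vertices j ≡ w} (λ w j → vertices j Fin.≟ w)
              (λ eq eq′ → trans (sym eq) eq′) (s≤s 3≤n)

    w : Fin (suc n)
    w = proj₁ other

    w≢v : w ≢ v
    w≢v = proj₂ other zero ∘ sym

    w≢x : w ≢ x
    w≢x = proj₂ other (suc zero) ∘ sym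

    w≢y : w ≢ y
    w≢y = proj₂ other (suc (suc zero)) ∘ sym

    delete : Fin n ↣ Fin (suc n)
    delete = mk↣ (punchIn-injective w _ _)

    G′ : Graph n
    G′ = induced (graph g) delete

    G′∈ : P n G′
    G′∈ = hereditary (graph g) delete (graph∈ g)

    adj-G′ : ∀ {a b} (w≢a : w ≢ a) (w≢b : w ≢ b) →
      adj (graph (number G′ G′∈)) (punchOut w≢a) (punchOut w≢b) ≡ adj (graph g) a b
    adj-G′ w≢a w≢b = trans (graph-number G′ G′∈ _ _)
      (cong₂ (adj (graph g)) (punchIn-punchOut w≢a) (punchIn-punchOut w≢b))

  ¬splitMember-≥ : 3 ≤ n → ¬ SplitMember n → ∀ {m} → n ≤ m → ¬ SplitMember m
  ¬splitMember-≥ {n} 3≤n ¬split n≤m = go (ℕ.≤⇒≤′ n≤m)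
    where
    go : ∀ {m} → n ≤′ m → ¬ SplitMember m
    go ≤′-refl        = ¬split
    go (≤′-step n≤′m) = go n≤′m ∘ splitMember-pred (ℕ.≤-trans 3≤n (ℕ.≤′⇒≤ n≤′m))

  -- Every member is then empty or complete, so the adjacency of its first two vertices determines
  -- it.
  ¬splitMember⇒≤2 : ¬ SplitMember (2 + n) → p (2 + n) ≤ 2
  ¬splitMember⇒≤2 ¬split =
    injective⇒≤ {f = λ g → Inverse.from 2↔Bool (adj (graph g) zero (suc zero))} λ {g} {h} eq →
      graph-injective λ i j → agree g h (Injection.injective (↔⇒↣ (↔-sym 2↔Bool)) eq) i j
    where
    agree : ∀ g h → adj (graph g) zero (suc zero) ≡ adj (graph h) zero (suc zero) →
      ∀ i j → adj (graph g) i j ≡ adj (graph h) i j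
    agree g h eq i j with i Fin.≟ j
    ... | yes refl = trans (adj-irrefl (graph g) i) (sym (adj-irrefl (graph h) i))
    ... | no i≢j   = begin
      adj (graph g) i j             ≡⟨ ¬split⇒homogeneous (graph g) (¬split ∘ (g ,_)) i≢j ⟩
      adj (graph g) zero (suc zero) ≡⟨ eq ⟩
      adj (graph h) zero (suc zero) ≡⟨ ¬split⇒homogeneous (graph h) (¬split ∘ (h ,_)) i≢j ⟨
      adj (graph h) i j             ∎
      where open ≡-Reasoning

  -- With no member on `n` vertices there is, by heredity, none on more, and the finitely many
  -- smaller ones would exhaust the class.
  infinite⇒inhabited : Infinite P → ∀ n → 0 < p n
  infinite⇒inhabited infinite n = ℕ.n≢0⇒n>0 λ pn≡0 → infinite (smaller , exhausts pn≡0)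
    where
    members : (m : ℕ) → List (Σ ℕ Graph)
    members m = map (λ x → m , graph x) (allFin (p m))

    smaller : List (Σ ℕ Graph)
    smaller = concatMap members (upTo n)

    exhausts : p n ≡ 0 → ∀ {m} (G : Graph m) → P m G → Any (λ H → G ≅ proj₂ H) smaller
    exhausts pn≡0 {m} G G∈ with m <? n
    ... | yes m<n =
      lose (∈-concatMap⁺ members (lose (∈-upTo⁺ m<n) (∈-map⁺ (λ x → m , graph x) (∈-allFin (number G G∈)))))
           (↔-id _ , λ i j → sym (graph-number G G∈ i j))
    ... | no m≮n  = contradiction (subst Fin pn≡0 (number (induced G restrict) (hereditary G restrict G∈))) λ ()
      where
      restrict : Fin n ↣ Fin m
      restrict = mk↣ (inject≤-injective (ℕ.≮⇒≥ m≮n) (ℕ.≮⇒≥ m≮n) _ _)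

  -- Otherwise the speed lies between 1 and 2 from `n` on. The contradiction yields an actual split
  -- because a finite search decides `SplitMember n`.
  nonconstant⇒splitMember : Infinite P → ¬ ConstantSpeed p → 3 ≤ n → SplitMember n
  nonconstant⇒splitMember {n} infinite ¬constant 3≤n = decidable-stable (splitMember? n) λ ¬split →
    ¬constant (1 , 1 , 2 , 1 , (z<s , z<s , z<s , z<s) , n , λ m n≤m →
      subst (1 ≤_) (sym (ℕ.*-identityˡ (p m))) (infinite⇒inhabited infinite m) ,
      subst (_≤ 2) (sym (ℕ.*-identityˡ (p m))) (≤2 (ℕ.≤-trans 3≤n n≤m) (¬splitMember-≥ 3≤n ¬split n≤m)))
    where
    ≤2 : ∀ {m} → 3 ≤ m → ¬ SplitMember m → p m ≤ 2
    ≤2 (s≤s (s≤s _)) = ¬splitMember⇒≤2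

  bounded⇒polynomial : Infinite P → ¬ ConstantSpeed p →
    (∃[ k ] ∀ {n} (G : Graph n) → P n G → cΔ G ≤ k × cμ G ≤ k) → PolynomialSpeed p
  bounded⇒polynomial infinite ¬constant (k , bounded) =
    -- The lower exponent `1 / 2` comes from `split⇒≤square`, the upper one from `codeCount≤`; split
    -- members are available from 3 on.
    1 , 2 , suc ((2 + k) * (k + k)) , 1 , (z<s , z<s , z<s , z<s) , 3 , λ n 3≤n → lower n 3≤n , upper n 3≤n
    where
    open ℕ.≤-Reasoning

    lower : ∀ n → 3 ≤ n → n ^ 1 ≤ p n ^ 2
    lower n 3≤n =
      let g , v , x , y , vxy = nonconstant⇒splitMember infinite ¬constant 3≤n
      in begin
        n ^ 1       ≡⟨ ℕ.^-identityʳ n ⟩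
        n           ≤⟨ split⇒≤square (graph∈ g) vxy ⟩
        p n * p n   ≡⟨ cong (p n *_) (ℕ.^-identityʳ (p n)) ⟨
        p n ^ 2     ∎

    upper : ∀ n → 3 ≤ n → p n ^ 1 ≤ n ^ suc ((2 + k) * (k + k))
    upper n@(suc _) 3≤n = begin
      p n ^ 1                           ≡⟨ ℕ.^-identityʳ (p n) ⟩
      p n                               ≤⟨ bounded⇒≤codeCount bounded zero ⟩
      codeCount n k                     ≤⟨ codeCount≤ n k (ℕ.<⇒≤ 3≤n) ⟩
      n ^ suc ((2 + k) * (k + k))       ∎

theorem15 : ∀ {ℓ : Level} (P : GraphClass ℓ) → IsProperty P → Hereditary P →
    (p : ℕ → ℕ) → IsSpeed P p → ¬ ConstantSpeed p →
    (PolynomialSpeed p ⇔ (∃[ k ] ∀ {n} (G : Graph n) → P n G → cΔ G ≤ k × cμ G ≤ k))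
theorem15 P property hereditary p speed ¬constant =
  mk⇔ polynomial⇒bounded (bounded⇒polynomial (IsProperty.infinite property) ¬constant)
  where open Speed P hereditary p speed
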